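{- Let $(G,\sigma)$ be a signed graph whose underlying graph $G$ has treewidth at most $2$. Then $\chi\big(\hat{G}^{[\sharp -2]}_{\mathrm{strong}}\big)\le 7$, where $\hat{G}^{[\sharp -2]}_{\mathrm{strong}}$ denotes the strong exact-distance $-2$ graph of $(G,\sigma)$.
   Context: A signed graph $(G,\sigma)$ is a (finite, simple) graph $G$ together with a signature $\sigma:E(G)\to\{+,-\}$. The sign of a path is the product of the signs of its edges; a path is negative if its sign is $-$. $d(x,y)$ is the distance in $G$. For a positive integer $k$, the strong exact-distance $-k$ graph of $(G,\sigma)$ is the (unsigned) graph with vertex set $V(G)$ in which $xy$ is an edge if and only if $d(x,y)=k$ and some $xy$-path of length $k$ is negative in $(G,\sigma)$. The treewidth of $G$ is the least $t$ such that $G$ is a subgraph of a $t$-tree, where a $t$-tree is either a clique on $t+1$ vertices or is obtained from a smaller $t$-tree by adding a vertex adjacent to $t$ pairwise adjacent vertices. -}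

module Defs where

open import Data.Nat using (ℕ; zero; suc; _<_; _≤_)
open import Data.Fin using (Fin; zero; suc)
open import Data.Fin.Subset using (Subset; _∈_; ∣_∣)
open import Data.Product using (Σ; ∃; ∃-syntax; _×_; _,_)
open import Data.List using (List; []; _∷_)
open import Data.List.Relation.Unary.Unique.Propositional using (Unique)
open import Relation.Binary.PropositionalEquality using (_≡_; _≢_)
open import Relation.Nullary using (¬_)
open import Function.Bundles using (_⇔_)
open import Function.Definitions using (Injective)

record Graph (n : ℕ) : Set₁ where
  field
    Adj    : Fin n → Fin n → Set
    symm   : ∀ {x y} → Adj x y → Adj y x
    irrefl : ∀ {x} → ¬ Adj x x

data Sign : Set where
  plus minus : Sign

_·_ : Sign → Sign → Sign
plus  · s = s
minus · plus = minus
minus · minus = plus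

-- A signature assigns a sign to each edge; we take it as a symmetric
-- function on pairs of vertices (its values on non-edges are irrelevant).
record SignedGraph (n : ℕ) : Set₁ where
  field
    graph  : Graph n
    σ      : Fin n → Fin n → Sign
    σ-symm : ∀ x y → σ x y ≡ σ y x
  open Graph graph public

module _ {n : ℕ} (Γ : SignedGraph n) where
  open SignedGraph Γ

  data Walk : Fin n → Fin n → ℕ → Set where
    stop : ∀ {x} → Walk x x zero
    step : ∀ {x y z k} → Adj x y → Walk y z k → Walk x z (suc k)

  vertices : ∀ {x y k} → Walk x y k → List (Fin n)
  vertices {x} stop = x ∷ []
  vertices {x} (step _ w) = x ∷ vertices w

  sign : ∀ {x y k} → Walk x y k → Sign
  sign stop = plus
  sign {x} (step {y = y} _ w) = σ x y · sign w

  Path : Fin n → Fin n → ℕ → Set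
  Path x y k = Σ (Walk x y k) (λ w → Unique (vertices w))

  Dist : Fin n → Fin n → ℕ → Set
  Dist x y k = Path x y k × (∀ j → j < k → ¬ Path x y j)

  StrongExactDistNeg : ℕ → Fin n → Fin n → Set
  StrongExactDistNeg k x y =
    Dist x y k × Σ (Path x y k) (λ p → sign (Σ.proj₁ p) ≡ minus)
    where open Data.Product using (module Σ)

_-Colourable_ : ∀ {n} → ℕ → (Fin n → Fin n → Set) → Set
_-Colourable_ {n} c E = Σ (Fin n → Fin c) λ f → ∀ x y → E x y → f x ≢ f y

data IsTTree (t : ℕ) : (m : ℕ) → (Fin m → Fin m → Set) → Set₁ where
  clique : ∀ {R : Fin (suc t) → Fin (suc t) → Set} →
           (∀ i j → R i j ⇔ (i ≢ j)) →
           IsTTree t (suc t) R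
  extend : ∀ {m} {R : Fin m → Fin m → Set} {R' : Fin (suc m) → Fin (suc m) → Set} →
           IsTTree t m R →
           (S : Subset m) → ∣ S ∣ ≡ t →
           (∀ i j → i ∈ S → j ∈ S → i ≢ j → R i j) →
           (∀ i j → R' (suc i) (suc j) ⇔ R i j) →
           (∀ i → R' zero (suc i) ⇔ (i ∈ S)) →
           (∀ i → R' (suc i) zero ⇔ (i ∈ S)) →
           ¬ R' zero zero →
           IsTTree t (suc m) R'

SubgraphOfTTree : ∀ {n} → ℕ → Graph n → Set₁
SubgraphOfTTree {n} t G =
  ∃[ m ] Σ (Fin m → Fin m → Set) λ R → IsTTree t m R ×
    Σ (Fin n → Fin m) λ f → Injective _≡_ _≡_ f ×
      (∀ x y → Graph.Adj G x y → R (f x) (f y))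

-- treewidth G ≤ w  (treewidth = least t with G a subgraph of a t-tree)
TreewidthAtMost : ∀ {n} → ℕ → Graph n → Set₁
TreewidthAtMost w G = ∃[ t ] (t ≤ w × SubgraphOfTTree t G)

{-# OPTIONS --safe #-}

-- Every vertex x of the 2-tree receives a colour and a sign vector g indexed by the seven colours,
-- such that every edge xz of the 2-tree has sign g(colour of z). Then the two end vertices of a
-- negative 2-walk through z have different colours. Call an edge xy of sign s, with colours a, b and
-- vectors g, h, good if g(b) = h(a) = s and among the other five colours the pairs (g, h) take the
-- values (s,s), (s,-s), (-s,s), (-s,-s) respectively 1, 1, 1, 2 times. A new vertex z joined to both
-- ends of a good edge, with arbitrary signs, can be given a colour and a vector making both new
-- edges good; so the states can be chosen greedily along the construction of the 2-tree.
--
-- All edges of the 2-tree are treated as if present: the colouring depends on the signature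
-- but not on which edges the subgraph has, so adjacency need not be decidable.
module Submission where

open import Defs
open import Data.Nat using (ℕ; zero; suc; _≤_; z≤n; s≤s)
open import Data.Nat.Properties using (≤-trans; ≤-reflexive; n≤1+n; ≤-pred)
open import Data.Fin using (Fin; zero; suc)
open import Data.Fin.Patterns
open import Data.Fin.Permutation
  using (Permutation′; id; transpose; flip; _∘ₚ_; _⟨$⟩ʳ_; _⟨$⟩ˡ_; inverseˡ; inverseʳ)
open import Data.Fin.Properties using (_≟_; all?; any?)
open import Data.Fin.Subset using (Subset; _∈_; _∉_; _-_; ∣_∣; ⊤)
open import Data.Fin.Subset.Properties
  using (_∈?_; nonempty?; x∈p⇒∣p-x∣<∣p∣; x∈p∧x≢y⇒x∈p-y; ∣⊤∣≡n; ∈⊤)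
open import Data.Product using (Σ; ∃-syntax; _×_; _,_; proj₁; proj₂)
open import Data.Sum using (_⊎_; inj₁; inj₂; [_,_]′)
open import Function using (_∘_; _on_)
open import Function.Bundles using (Equivalence)
open import Function.Definitions using (Injective)
open import Relation.Binary.PropositionalEquality
  using (_≡_; _≢_; refl; sym; trans; cong; cong₂; subst; module ≡-Reasoning)
open import Relation.Nullary using (¬_; Dec; yes; no; contradiction)
open import Relation.Nullary.Decidable using (_×-dec_; ¬?; map′; decidable-stable; from-yes)

-- Colours, sign vectors and good edges

-- Positions 0 and 1 are the colours of the two ends of an edge of sign s; positions 2, 3, 4 and
-- 5, 6 are the colours of class (s,s), (s,-s), (-s,s) and (-s,-s). The value at an end's own
-- colour is immaterial; fixing it to be plus avoids exceptions below.
pattern₀ : Sign → Fin 7 → Sign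
pattern₀ s 0F = plus
pattern₀ s 1F = s
pattern₀ s 2F = s
pattern₀ s 3F = s
pattern₀ s 4F = minus · s
pattern₀ s 5F = minus · s
pattern₀ s 6F = minus · s

-- Passes to the view from the other end, where the classes (s,-s) and (-s,s) trade places.
swap : Permutation′ 7
swap = transpose 0F 1F ∘ₚ transpose 3F 4F

State : Set
State = Permutation′ 7 × Sign

colour : State → Fin 7
colour (e , _) = e ⟨$⟩ʳ 0F

vector : State → Fin 7 → Sign
vector (e , s) c = pattern₀ s (e ⟨$⟩ˡ c)

-- The ordering stored in a state is one of many with the same colour and vector; each incident edge
-- may need a different one.
record Frame (e : Permutation′ 7) (s : Sign) (x : State) : Set where
  constructor frame
  field
    own  : e ⟨$⟩ʳ 0F ≡ colour x
    seen : ∀ i → vector x (e ⟨$⟩ʳ i) ≡ pattern₀ s i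

Good : Sign → State → State → Set
Good s x y = ∃[ e ] Frame e s x × Frame (swap ∘ₚ e) s y

Frame-own : ∀ e s → Frame e s (e , s)
Frame-own e s = frame refl λ i → cong (pattern₀ s) (inverseˡ e)

Frame-resp : ∀ {e e′ s x} → (∀ i → e′ ⟨$⟩ʳ i ≡ e ⟨$⟩ʳ i) → Frame e s x → Frame e′ s x
Frame-resp {x = x} eq (frame own seen) =
  frame (trans (eq 0F) own) λ i → trans (cong (vector x) (eq i)) (seen i)

swap-involutive : ∀ i → swap ⟨$⟩ʳ (swap ⟨$⟩ʳ i) ≡ i
swap-involutive = from-yes (all? λ i → swap ⟨$⟩ʳ (swap ⟨$⟩ʳ i) ≟ i)

Good-sym : ∀ {s x y} → Good s x y → Good s y x
Good-sym (e , fx , fy) =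
  swap ∘ₚ e , fy , Frame-resp (cong (e ⟨$⟩ʳ_) ∘ swap-involutive) fx

Good⇒vector : ∀ {s x y} → Good s x y → vector x (colour y) ≡ s
Good⇒vector {x = x} (e , frame _ seen , frame own _) = trans (cong (vector x) (sym own)) (seen 1F)

-- Completing a good edge to a triangle

_≟ₛ_ : (s t : Sign) → Dec (s ≡ t)
plus  ≟ₛ plus  = yes refl
plus  ≟ₛ minus = no λ ()
minus ≟ₛ plus  = no λ ()
minus ≟ₛ minus = yes refl

Reframe : Permutation′ 7 → Sign → Sign → Set
Reframe θ s p = θ ⟨$⟩ʳ 0F ≡ 0F × (∀ i → pattern₀ s (θ ⟨$⟩ʳ i) ≡ pattern₀ p i)

reframe? : ∀ θ s p → Dec (Reframe θ s p)
reframe? θ s p = (θ ⟨$⟩ʳ 0F ≟ 0F) ×-dec all? λ i → pattern₀ s (θ ⟨$⟩ʳ i) ≟ₛ pattern₀ p i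

Frame-reframe : ∀ {e s p x} θ → Frame e s x → Reframe θ s p → Frame (θ ∘ₚ e) p x
Frame-reframe {e} θ (frame own seen) (fix , pat) =
  frame (trans (cong (e ⟨$⟩ʳ_) fix) own) λ i → trans (seen (θ ⟨$⟩ʳ i)) (pat i)

-- Found by computer search: the renumbering of the colours, as seen from one end x of the edge xy,
-- when passing from xy to xz, where the arguments are the signs of xz and yz relative to that of xy.
fork : Sign → Sign → Permutation′ 7
fork plus  plus  = transpose 1F 2F ∘ₚ transpose 4F 5F
fork plus  minus = transpose 1F 3F ∘ₚ transpose 4F 5F
fork minus plus  = transpose 1F 4F ∘ₚ transpose 1F 3F ∘ₚ transpose 1F 5F ∘ₚ transpose 2F 6F
fork minus minus = transpose 1F 5F ∘ₚ transpose 1F 3F ∘ₚ transpose 1F 4F ∘ₚ transpose 2F 6F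

-- From z's point of view: passing from the edge zx to the edge zy.
turn : Sign → Sign → Permutation′ 7
turn a b = swap ∘ₚ fork b a ∘ₚ swap ∘ₚ flip (fork a b) ∘ₚ swap

allSigns? : {P : Sign → Set} → (∀ s → Dec (P s)) → Dec (∀ s → P s)
allSigns? P? = map′ (λ { (p , m) plus → p ; (p , m) minus → m }) (λ f → f plus , f minus)
                    (P? plus ×-dec P? minus)

fork-reframe : ∀ s p q → Reframe (fork (s · p) (s · q)) s p
fork-reframe = from-yes (allSigns? λ s → allSigns? λ p → allSigns? λ q →
                         reframe? (fork (s · p) (s · q)) s p)

-- This ties the two forks together: `z` has a single vector, which must fit both `zx` and `zy`.
turn-reframe : ∀ s p q → Reframe (turn (s · p) (s · q)) p q
turn-reframe = from-yes (allSigns? λ s → allSigns? λ p → allSigns? λ q →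
                         reframe? (turn (s · p) (s · q)) p q)

-- All four classes are nonempty, so some colour has sign `p` at `x` and `q` at `y`; `z` takes it.
Good-extend : ∀ {s x y} p q → Good s x y → ∃[ z ] Good p x z × Good q y z
Good-extend {s} {x} {y} p q (e , fx , fy) =
  z ,
  (π ∘ₚ e , Frame-reframe π fx (fork-reframe s p q) , Frame-own _ p) ,
  (ρ ∘ₚ swap ∘ₚ e , Frame-reframe ρ fy (fork-reframe s q p) ,
   Frame-resp cancel (Frame-reframe (turn (s · p) (s · q)) (Frame-own _ p) (turn-reframe s p q)))
  where
  π ρ : Permutation′ 7
  π = fork (s · p) (s · q)
  ρ = fork (s · q) (s · p)

  z : State
  z = swap ∘ₚ π ∘ₚ e , p

  cancel : ∀ i → (swap ∘ₚ ρ ∘ₚ swap ∘ₚ e) ⟨$⟩ʳ i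
               ≡ (turn (s · p) (s · q) ∘ₚ swap ∘ₚ π ∘ₚ e) ⟨$⟩ʳ i
  -- In the unfolded `turn`, two swaps meet and cancel, then `π` meets its inverse.
  cancel i = cong (e ⟨$⟩ʳ_) (sym (trans (cong (π ⟨$⟩ʳ_) (swap-involutive _)) (inverseʳ π)))

Good-exists : ∀ x → ∃[ s ] ∃[ y ] Good s x y
Good-exists (e , s) = s , (swap ∘ₚ e , s) , e , Frame-own e s , Frame-own _ s

-- Greedy choice along the construction of the tree

data AtMostTwo {m} (S : Subset m) : Set where
  none : (∀ i → i ∉ S) → AtMostTwo S
  one  : ∀ u → (∀ i → i ∈ S → i ≡ u) → AtMostTwo S
  two  : ∀ u v → u ∈ S → v ∈ S → u ≢ v → (∀ i → i ∈ S → i ≡ u ⊎ i ≡ v) → AtMostTwo S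

∣S∣≤2⇒AtMostTwo : ∀ {m} (S : Subset m) → ∣ S ∣ ≤ 2 → AtMostTwo S
∣S∣≤2⇒AtMostTwo S bound with nonempty? S
... | no empty = none λ i i∈S → empty (i , i∈S)
... | yes (u , u∈S) with any? (λ v → (v ∈? S) ×-dec ¬? (u ≟ v))
...   | no unique = one u λ i i∈S → decidable-stable (i ≟ u) λ i≢u → unique (i , i∈S , i≢u ∘ sym)
...   | yes (v , v∈S , u≢v) = two u v u∈S v∈S u≢v covered
  where
  covered : ∀ i → i ∈ S → i ≡ u ⊎ i ≡ v
  covered i i∈S with i ≟ u | i ≟ v
  ... | yes i≡u | _       = inj₁ i≡u
  ... | no  _   | yes i≡v = inj₂ i≡v
  ... | no  i≢u | no  i≢v = contradiction (≤-trans three bound) λ { (s≤s (s≤s ())) }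
    where
    v∈S-u = x∈p∧x≢y⇒x∈p-y v∈S (u≢v ∘ sym)
    i∈S-u = x∈p∧x≢y⇒x∈p-y i∈S i≢u

    three : 3 ≤ ∣ S ∣
    -- Deleting `u`, `v` and `i` in turn lowers the size each time.
    three = ≤-trans (s≤s (≤-trans (s≤s (≤-trans (s≤s z≤n)
      (x∈p⇒∣p-x∣<∣p∣ (x∈p∧x≢y⇒x∈p-y i∈S-u i≢v))))
      (x∈p⇒∣p-x∣<∣p∣ v∈S-u)))
      (x∈p⇒∣p-x∣<∣p∣ u∈S)

Painting : ∀ {m} → (Fin m → Fin m → Sign) → (Fin m → Fin m → Set) → Set
Painting {m} τ R = Σ (Fin m → State) λ st → ∀ i j → R i j → Good (τ i j) (st i) (st j)

Good-extend-subset : ∀ {m} {τ R} ((st , _) : Painting {m} τ R) (S : Subset m) → ∣ S ∣ ≤ 2 →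
                     (∀ i j → i ∈ S → j ∈ S → i ≢ j → R i j) → (p : Fin m → Sign) →
                     ∃[ z ] (∀ i → i ∈ S → Good (p i) (st i) z)
Good-extend-subset (st , good) S bound adj p with ∣S∣≤2⇒AtMostTwo S bound
... | none empty = (id , plus) , λ i i∈S → contradiction i∈S (empty i)
... | one u unique =
  -- A lone neighbour gets a fictitious partner, with arbitrary sign `plus` towards it.
  let _ , _ , g      = Good-exists (st u)
      z , good-u , _ = Good-extend (p u) plus g
  in z , λ i i∈S → subst (λ j → Good (p j) (st j) z) (sym (unique i i∈S)) good-u
... | two u v u∈S v∈S u≢v covered =
  z , λ i i∈S → [ toGood good-u , toGood good-v ]′ (covered i i∈S)
  where
  extension = Good-extend (p u) (p v) (good u v (adj u v u∈S v∈S u≢v))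
  z         = proj₁ extension
  good-u    = proj₁ (proj₂ extension)
  good-v    = proj₂ (proj₂ extension)

  toGood : ∀ {i j} → Good (p j) (st j) z → i ≡ j → Good (p i) (st i) z
  toGood g refl = g

Symmetric : ∀ {m} → (Fin m → Fin m → Sign) → Set
Symmetric τ = ∀ i j → τ i j ≡ τ j i

Painting-extend : ∀ {m τ} {R : Fin m → Fin m → Set} {R′ : Fin (suc m) → Fin (suc m) → Set} →
                  Symmetric τ → Painting (τ on suc) R →
                  (S : Subset m) → ∣ S ∣ ≤ 2 →
                  (∀ i j → i ∈ S → j ∈ S → i ≢ j → R i j) →
                  (∀ i j → R′ (suc i) (suc j) → R i j) →
                  (∀ i → R′ zero (suc i) → i ∈ S) →
                  (∀ i → R′ (suc i) zero → i ∈ S) →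
                  ¬ R′ zero zero →
                  Painting τ R′
Painting-extend {m} {τ} {R} {R′} τ-sym (st , good) S bound adj old new newᵒ loopless = st′ , good′
  where
  extension = Good-extend-subset (st , good) S bound adj λ i → τ (suc i) zero

  st′ : Fin (suc m) → State
  st′ zero    = proj₁ extension
  st′ (suc i) = st i

  good′ : ∀ i j → R′ i j → Good (τ i j) (st′ i) (st′ j)
  good′ zero    zero    r = contradiction r loopless
  good′ zero    (suc j) r = subst (λ s → Good s (st′ zero) (st j)) (τ-sym (suc j) zero)
                                  (Good-sym (proj₂ extension j (new j r)))
  good′ (suc i) zero    r = proj₂ extension i (newᵒ i r)
  good′ (suc i) (suc j) r = good i j (old i j r)

-- Each vertex is joined to all earlier ones, of which there are at most two.
Painting-complete : ∀ {m} {τ} → m ≤ 3 → Symmetric τ → Painting {m} τ _≢_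
Painting-complete {zero}  bound τ-sym = (λ ()) , λ ()
Painting-complete {suc m} bound τ-sym =
  Painting-extend τ-sym
    (Painting-complete (≤-trans (n≤1+n m) bound) (λ i j → τ-sym (suc i) (suc j)))
    ⊤ (≤-trans (≤-reflexive (∣⊤∣≡n m)) (≤-pred bound))
    (λ _ _ _ _ i≢j → i≢j) (λ _ _ i≢j → i≢j ∘ cong suc)
    (λ _ _ → ∈⊤) (λ _ _ → ∈⊤) (λ 0≢0 → 0≢0 refl)

TTree⇒Painting : ∀ {t m R τ} → t ≤ 2 → IsTTree t m R → Symmetric τ → Painting τ R
TTree⇒Painting t≤2 (clique complete) τ-sym =
  let st , good = Painting-complete (s≤s t≤2) τ-sym
  in st , λ i j r → good i j (Equivalence.to (complete i j) r)
TTree⇒Painting t≤2 (extend tree S size adj old new newᵒ loopless) τ-sym =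
  Painting-extend τ-sym (TTree⇒Painting t≤2 tree λ i j → τ-sym (suc i) (suc j))
    S (≤-trans (≤-reflexive size) t≤2) adj
    (λ i j → Equivalence.to (old i j))
    (λ i → Equivalence.to (new i))
    (λ i → Equivalence.to (newᵒ i))
    loopless

-- Transfer to the signed graph

module _ {n m} (f : Fin n → Fin m) (σ : Fin n → Fin n → Sign) where

  private
    Preimage : Fin m → Set
    Preimage u = ∃[ x ] f x ≡ u

    sign-of : ∀ {u v} → Dec (Preimage u) → Dec (Preimage v) → Sign
    sign-of (yes (x , _)) (yes (y , _)) = σ x y
    -- Tree vertices outside the image of `f` get a default sign.
    sign-of (yes _)       (no _)        = plus
    sign-of (no _)        _             = plus

  pushforward : Fin m → Fin m → Sign
  pushforward u v = sign-of (any? λ x → f x ≟ u) (any? λ y → f y ≟ v)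

  pushforward-sym : (∀ x y → σ x y ≡ σ y x) → Symmetric pushforward
  pushforward-sym σ-sym u v with any? (λ x → f x ≟ u) | any? (λ y → f y ≟ v)
  ... | yes (x , _) | yes (y , _) = σ-sym x y
  ... | yes _       | no _        = refl
  ... | no _        | yes _       = refl
  ... | no _        | no _        = refl

  pushforward-image : Injective _≡_ _≡_ f → ∀ x y → pushforward (f x) (f y) ≡ σ x y
  pushforward-image inj x y with any? (λ x′ → f x′ ≟ f x) | any? (λ y′ → f y′ ≟ f y)
  ... | yes (x′ , p) | yes (y′ , q) = cong₂ σ (inj p) (inj q)
  ... | yes _        | no ∄y        = contradiction (y , refl) ∄y
  ... | no ∄x        | _            = contradiction (x , refl) ∄x

-- The trailing `plus` is the sign of the empty walk ending a 2-walk.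
·-self : ∀ s → s · (s · plus) ≢ minus
·-self plus  ()
·-self minus ()

theorem5 : ∀ {n : ℕ} (Γ : SignedGraph n) →
    TreewidthAtMost 2 (SignedGraph.graph Γ) →
    7 -Colourable (StrongExactDistNeg Γ 2)
theorem5 {n} Γ (t , t≤2 , m , R , tree , f , f-inj , f-edge) = colour ∘ st , proper
  where
  open SignedGraph Γ

  painting : Painting (pushforward f σ) R
  painting = TTree⇒Painting t≤2 tree (pushforward-sym f σ σ-symm)

  st : Fin n → State
  st x = proj₁ painting (f x)

  vector-colour : ∀ {x y} → Adj x y → vector (st x) (colour (st y)) ≡ σ x y
  vector-colour {x} {y} xy =
    trans (Good⇒vector (proj₂ painting (f x) (f y) (f-edge x y xy)))
          (pushforward-image f σ f-inj x y)

  proper : ∀ x y → StrongExactDistNeg Γ 2 x y → colour (st x) ≢ colour (st y)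
  proper x y (_ , (step {y = z} xz (step zy stop) , _) , negative) same =
    ·-self (σ x z) (subst (λ s → σ x z · (s · plus) ≡ minus) σzy≡σxz negative)
    where
    -- Both signs are the entry of the vector of `z` at the common colour.
    σzy≡σxz : σ z y ≡ σ x z
    σzy≡σxz = begin
      σ z y                          ≡⟨ vector-colour zy ⟨
      vector (st z) (colour (st y))  ≡⟨ cong (vector (st z)) same ⟨
      vector (st z) (colour (st x))  ≡⟨ vector-colour (symm xz) ⟩
      σ z x                          ≡⟨ σ-symm z x ⟩
      σ x z                          ∎
      where open ≡-Reasoning
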